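{- Let $0 \le k \le n$ be integers and let $L$ be a multiplicative sublattice of $\mathbb{Z}^n$ of co-rank $k$. Then every $\mathbb{Z}$-basis of $L$ forms the rows of an $(n-k) \times n$ matrix $M$ with exactly $n-k$ distinct non-zero columns (that is, the set of non-zero vectors occurring as columns of $M$ has exactly $n-k$ elements).
   Context: $\mathbb{Z}^n$ is the ring of $n$-tuples of integers with componentwise addition and multiplication. A sublattice of $\mathbb{Z}^n$ is a $\mathbb{Z}$-submodule $L \subseteq \mathbb{Z}^n$; its co-rank is $n - \operatorname{rank}_{\mathbb{Z}} L$. A sublattice $L$ is multiplicative if $u \cdot v \in L$ for all $u,v \in L$ (it is not required to contain the identity $(1,\dots,1)$). -}

module Defs where

open import Algebra.Bundles using (CommutativeRing)
import Algebra.Construct.Pointwise as Pointwise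
open import Algebra.Properties.Monoid.Sum using (sum)
open import Data.Fin.Base using (Fin)
open import Data.Integer.Base using (ℤ; 0ℤ; _*_)
open import Data.Integer.Properties using (+-*-commutativeRing)
open import Data.Nat.Base using (ℕ; _+_; _≤_)
open import Data.Product.Base using (Σ-syntax; ∃-syntax; _×_)
open import Data.Vec.Functional using (Vector)
open import Function.Bundles using (_⇔_)
open import Function.Definitions using (Injective)
open import Level using (Level; 0ℓ; suc)
open import Relation.Binary.PropositionalEquality.Core using (_≡_)
open import Relation.Nullary.Negation.Core using (¬_)
open import Relation.Unary using (Pred; _∈_)

-- The product ring ℤⁿ. Its carrier is the function type Fin n → ℤ, so
-- equality of vectors is the pointwise relation _≈_.
ℤ^ : ℕ → CommutativeRing 0ℓ 0ℓ
ℤ^ n = Pointwise.commutativeRing (Fin n) +-*-commutativeRing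

module ℤ^ (n : ℕ) = CommutativeRing (ℤ^ n)

infixr 7 _•_
_•_ : {n : ℕ} → ℤ → Vector ℤ n → Vector ℤ n
(c • v) j = c * v j

record Sublattice (n : ℕ) (ℓ : Level) : Set (suc ℓ) where
  open ℤ^ n using (_≈_; 0#) renaming (_+_ to _⊕_)
  field
    member   : Pred (Vector ℤ n) ℓ
    resp-≈   : ∀ {u v} → u ≈ v → u ∈ member → v ∈ member
    0-closed : 0# ∈ member
    +-closed : ∀ {u v} → u ∈ member → v ∈ member → (u ⊕ v) ∈ member
    •-closed : ∀ c {v} → v ∈ member → (c • v) ∈ member

open Sublattice public using (member)

Multiplicative : {n : ℕ} {ℓ : Level} → Sublattice n ℓ → Set ℓ
Multiplicative {n} L = ∀ {u v} → u ∈ member L → v ∈ member L → (u ⊗ v) ∈ member L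
  where open ℤ^ n using () renaming (_*_ to _⊗_)

-- M i is the i-th row, M i j the entry in row i and column j.
Matrix : ℕ → ℕ → Set
Matrix m n = Vector (Vector ℤ n) m

column : {m n : ℕ} → Matrix m n → Fin n → Vector ℤ m
column M j i = M i j

linearCombination : {m n : ℕ} → Vector ℤ m → Matrix m n → Vector ℤ n
linearCombination {n = n} c M = sum (ℤ^.+-monoid n) (λ i → c i • M i)

LinearlyIndependent : {m n : ℕ} → Matrix m n → Set
LinearlyIndependent {m} {n} M =
  ∀ (c : Vector ℤ m) → linearCombination c M ≈ 0# → ∀ i → c i ≡ 0ℤ
  where open ℤ^ n using (_≈_; 0#)

module _ {n : ℕ} {ℓ : Level} (L : Sublattice n ℓ) where

  open ℤ^ n using (_≈_)

  record IsBasis {m : ℕ} (b : Matrix m n) : Set ℓ where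
    field
      members     : ∀ i → b i ∈ member L
      independent : LinearlyIndependent b
      spanning    : ∀ {v} → v ∈ member L →
                    ∃[ c ] v ≈ linearCombination c b

  -- The rank is the largest size of a ℤ-linearly independent family in L.
  record HasRank (r : ℕ) : Set ℓ where
    field
      family      : Matrix r n
      members     : ∀ i → family i ∈ member L
      independent : LinearlyIndependent family
      maximal     : ∀ {m} (M : Matrix m n) → (∀ i → M i ∈ member L) →
                    LinearlyIndependent M → m ≤ r

  HasCorank : ℕ → Set ℓ
  HasCorank k = ∃[ r ] HasRank r × r + k ≡ n

NonzeroColumn : {m n : ℕ} → Matrix m n → Pred (Vector ℤ m) 0ℓ
NonzeroColumn {m} M v = ¬ (v ≈ 0#) × (∃[ j ] v ≈ column M j)
  where open ℤ^ m using (_≈_; 0#)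

-- The set of vectors satisfying P, taken up to _≈_, has exactly s elements.
HasSize : {m : ℕ} → Pred (Vector ℤ m) 0ℓ → ℕ → Set
HasSize {m} P s =
  Σ[ e ∈ Vector (Vector ℤ m) s ]
    Injective _≡_ _≈_ e × (∀ v → P v ⇔ (∃[ i ] v ≈ e i))
  where open ℤ^ m using (_≈_)

{-# OPTIONS --safe #-}

-- Let r be the rank of L. The coefficient matrix of r independent vectors of L
-- in a basis M is independent, and so are the rows of M restricted to the
-- distinct non-zero columns; since independent families in ℤˢ have at most s
-- members, this gives r ≤ m and m ≤ s for s distinct non-zero columns.
-- Conversely L, being multiplicative, contains for each of these columns a
-- vector vanishing on the others but not on it. Those s vectors are
-- independent, so s ≤ r.

module Submission where

open import Defs
open import Algebra.Bundles using (CommutativeRing)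
import Algebra.Properties.Semiring.Sum as SemiringSum
open import Data.Fin.Base using (Fin; zero; suc; punchIn; punchOut)
open import Data.Fin.Properties as Fin
  using (all?; any?; punchIn-punchOut; punchInᵢ≢i; ¬∀⟶∃¬)
open import Data.Integer.Base using (ℤ; 0ℤ; 1ℤ; _*_; _-_; -_)
  renaming (_+_ to _+ℤ_)
open import Data.Integer.Properties as ℤ using (+-*-commutativeRing)
open import Data.Integer.Solver using (module +-*-Solver)
open import Data.List.Base using (List; _∷_; deduplicate; filter; length;
  lookup; tabulate)
open import Data.List.Membership.Propositional.Properties using (∈-lookup)
import Data.List.Membership.Setoid as Membership
import Data.List.Membership.Setoid.Properties as Membershipₚ
open import Data.List.Relation.Unary.All using (_∷_)
import Data.List.Relation.Unary.All as All
open import Data.List.Relation.Unary.AllPairs using (_∷_)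
import Data.List.Relation.Unary.Any as Any
import Data.List.Relation.Unary.Any.Properties as Anyₚ
open import Data.List.Relation.Unary.Unique.Setoid using (Unique)
open import Data.List.Relation.Unary.Unique.DecSetoid.Properties
  using (deduplicate-!)
open import Data.Nat.Base using (ℕ; zero; suc; _≤_; _∸_; z≤n; s≤s)
open import Data.Nat.Properties using (≤-antisym; ≤-trans; m+n∸n≡m)
open import Data.Product.Base using (∃-syntax; _×_; _,_; proj₁; proj₂)
open import Data.Sum.Base using ([_,_]′)
open import Data.Vec.Functional as Vector using (Vector)
open import Data.Vec.Functional.Properties
  using (updateAt-updates; updateAt-minimal)
import Data.Vec.Functional.Relation.Binary.Pointwise.Properties as Pointwise
open import Function.Base using (_∘_; id)
open import Function.Bundles using (mk⇔; Equivalence)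
open import Function.Definitions using (Injective)
open import Level using (Level; 0ℓ)
open import Relation.Binary.Bundles using (Setoid; DecSetoid)
open import Relation.Binary.PropositionalEquality.Core
  using (_≡_; _≢_; refl; sym; trans; cong; subst)
open import Relation.Binary.PropositionalEquality.Properties
  using (module ≡-Reasoning)
open import Relation.Nullary.Decidable.Core using (yes; no; ¬?; decidable-stable)
open import Relation.Nullary.Negation.Core using (¬_; contradiction)
open import Relation.Unary using (_∈_)

open +-*-Solver using (solve; _:=_; _:+_; _:*_; _:-_; :-_)
open SemiringSum (CommutativeRing.semiring +-*-commutativeRing)
  using (sum; sum-syntax; sum-cong-≋; sum-replicate-zero; sum-remove;
         ∑-distrib-+; ∑-comm; *-distribˡ-sum; *-distribʳ-sum)

private
  variable
    ℓ : Level
    m n r s t : ℕ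

-- Sums and linear independence, coordinatewise

sum-zero : (f : Vector ℤ m) → (∀ i → f i ≡ 0ℤ) → sum f ≡ 0ℤ
sum-zero {m} f f≡0 = trans (sum-cong-≋ f≡0) (sum-replicate-zero m)

sum-single : (f : Vector ℤ m) (k : Fin m) → (∀ i → i ≢ k → f i ≡ 0ℤ) →
             sum f ≡ f k
sum-single {suc m} f k f≡0 = begin
  sum f                             ≡⟨ sum-remove {i = k} f ⟩
  f k +ℤ sum (Vector.removeAt f k)  ≡⟨ cong (f k +ℤ_) (sum-zero (Vector.removeAt f k)
                                         λ i → f≡0 (punchIn k i) (punchInᵢ≢i k i)) ⟩
  f k +ℤ 0ℤ                         ≡⟨ ℤ.+-identityʳ (f k) ⟩
  f k                               ∎
  where open ≡-Reasoning

linearCombination-lookup : (c : Vector ℤ m) (M : Matrix m n) (j : Fin n) →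
                           linearCombination c M j ≡ ∑[ i < m ] (c i * M i j)
linearCombination-lookup {zero}  c M j = refl
linearCombination-lookup {suc m} c M j =
  cong (c zero * M zero j +ℤ_) (linearCombination-lookup (c ∘ suc) (M ∘ suc) j)

-- `linearCombination` is a sum in the product ring; reading it one coordinate at a time turns a
-- relation between rows into integer equations, to which the scalar sum lemmas apply.
independent⁺ : (M : Matrix m n) →
               (∀ c → (∀ j → ∑[ i < m ] (c i * M i j) ≡ 0ℤ) → ∀ i → c i ≡ 0ℤ) →
               LinearlyIndependent M
independent⁺ M ind c cM≈0 =
  ind c λ j → trans (sym (linearCombination-lookup c M j)) (cM≈0 j)

independent⁻ : (M : Matrix m n) → LinearlyIndependent M →
               ∀ c → (∀ j → ∑[ i < m ] (c i * M i j) ≡ 0ℤ) → ∀ i → c i ≡ 0ℤ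
independent⁻ M ind c cM≡0 =
  ind c λ j → trans (linearCombination-lookup c M j) (cM≡0 j)

*-cancelˡ-0 : ∀ {a b} → a ≢ 0ℤ → a * b ≡ 0ℤ → b ≡ 0ℤ
*-cancelˡ-0 {a} a≢0 ab≡0 =
  [ (λ a≡0 → contradiction a≡0 a≢0) , id ]′ (ℤ.i*j≡0⇒i≡0∨j≡0 a ab≡0)

factor-difference : ∀ a b c → a * b +ℤ (- c) * a ≡ a * (b - c)
factor-difference =
  solve 3 (λ a b c → a :* b :+ (:- c) :* a := a :* (b :- c)) refl

elimination-identity : ∀ c x y a z →
                       c * - x * y +ℤ a * c * z ≡ c * (a * z - x * y)
elimination-identity = solve 5 (λ c x y a z →
  c :* :- x :* y :+ a :* c :* z := c :* (a :* z :- x :* y)) refl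

-- Fraction-free Gaussian elimination

-- Cross-multiplying by the pivot `A zero q` replaces division, so entries stay in ℤ. Column `q`
-- becomes zero and is deleted only later, through `punchIn q`.
eliminate : Matrix (suc m) n → Fin n → Matrix m n
eliminate A q i j = A zero q * A (suc i) j - A (suc i) q * A zero j

eliminate-pivot : (A : Matrix (suc m) n) (q : Fin n) (i : Fin m) →
                  eliminate A q i q ≡ 0ℤ
eliminate-pivot A q i = ℤ.i≡j⇒i-j≡0 (ℤ.*-comm (A zero q) (A (suc i) q))

-- Pulls coefficients on the eliminated rows back to the rows of `A`; the head collects the
-- multiples of row `zero` that were subtracted.
eliminate-coefficients : Matrix (suc m) n → Fin n → Vector ℤ m → Vector ℤ (suc m)
eliminate-coefficients {m} A q c =
  (∑[ i < m ] (c i * - A (suc i) q)) Vector.∷ λ i → A zero q * c i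

eliminate-sum : (A : Matrix (suc m) n) (q : Fin n) (c : Vector ℤ m) (j : Fin n) →
                ∑[ i < suc m ] (eliminate-coefficients A q c i * A i j) ≡
                ∑[ i < m ] (c i * eliminate A q i j)
eliminate-sum {m} A q c j = begin
  (∑[ i < m ] (c i * - A (suc i) q)) * A zero j +ℤ
    ∑[ i < m ] (A zero q * c i * A (suc i) j)
      ≡⟨ cong (_+ℤ ∑[ i < m ] (A zero q * c i * A (suc i) j))
           (*-distribʳ-sum (A zero j) (λ i → c i * - A (suc i) q)) ⟩
  ∑[ i < m ] (c i * - A (suc i) q * A zero j) +ℤ
    ∑[ i < m ] (A zero q * c i * A (suc i) j)
      ≡⟨ sym (∑-distrib-+ (λ i → c i * - A (suc i) q * A zero j)
                          (λ i → A zero q * c i * A (suc i) j)) ⟩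
  ∑[ i < m ] (c i * - A (suc i) q * A zero j +ℤ A zero q * c i * A (suc i) j)
      ≡⟨ sum-cong-≋ (λ i →
           elimination-identity (c i) (A (suc i) q) (A zero j) (A zero q) (A (suc i) j)) ⟩
  ∑[ i < m ] (c i * eliminate A q i j) ∎
  where
  open ≡-Reasoning

-- A relation between the shortened rows also holds in column `q`, where the eliminated rows vanish.
-- Pulled back to `A`, it has tail coefficients `A zero q * c i`, and the non-zero pivot cancels.
eliminate-independent : (A : Matrix (suc m) (suc n)) (q : Fin (suc n)) →
                        A zero q ≢ 0ℤ → LinearlyIndependent A →
                        LinearlyIndependent (λ i → eliminate A q i ∘ punchIn q)
eliminate-independent {m} A q a≢0 ind = independent⁺ _ λ c cB≡0 i →
  *-cancelˡ-0 a≢0 (independent⁻ A ind (eliminate-coefficients A q c)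
    (λ j → trans (eliminate-sum A q c j) (combination≡0 c cB≡0 j)) (suc i))
  where
  combination≡0 : ∀ c → (∀ j → ∑[ i < m ] (c i * eliminate A q i (punchIn q j)) ≡ 0ℤ) →
                  ∀ j → ∑[ i < m ] (c i * eliminate A q i j) ≡ 0ℤ
  combination≡0 c cB≡0 j with q Fin.≟ j
  ... | yes refl = sum-zero (λ i → c i * eliminate A q i q) λ i →
          trans (cong (c i *_) (eliminate-pivot A q i)) (ℤ.*-zeroʳ (c i))
  ... | no q≢j   = subst (λ j → ∑[ i < m ] (c i * eliminate A q i j) ≡ 0ℤ)
          (punchIn-punchOut q≢j) (cB≡0 (punchOut q≢j))

-- If row `k` were zero, the unit vector `δ` at `k` would be a non-trivial relation.
independent⇒nonzero-row : (A : Matrix m n) → LinearlyIndependent A →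
                          ∀ k → ¬ (∀ j → A k j ≡ 0ℤ)
independent⇒nonzero-row {m} A ind k Ak≡0 =
  1≢0 (trans (sym δkk) (independent⁻ A ind δ δA≡0 k))
  where
  1≢0 : 1ℤ ≢ 0ℤ
  1≢0 ()
  δ : Vector ℤ m
  δ = Vector.updateAt (λ _ → 0ℤ) k (λ _ → 1ℤ)
  δkk : δ k ≡ 1ℤ
  δkk = updateAt-updates k (λ _ → 0ℤ)
  δA≡0 : ∀ j → ∑[ i < m ] (δ i * A i j) ≡ 0ℤ
  δA≡0 j = trans
    (sum-single (λ i → δ i * A i j) k λ i i≢k →
      cong (_* A i j) (updateAt-minimal i k (λ _ → 0ℤ) i≢k))
    (trans (cong (δ k *_) (Ak≡0 j)) (ℤ.*-zeroʳ (δ k)))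

-- By induction: row `zero` has a non-zero entry, and pivoting on it removes one row and one column.
independent⇒≤ : (A : Matrix m n) → LinearlyIndependent A → m ≤ n
independent⇒≤ {zero}          A ind = z≤n
independent⇒≤ {suc m} {zero}  A ind =
  contradiction (λ ()) (independent⇒nonzero-row A ind zero)
independent⇒≤ {suc m} {suc n} A ind with any? (λ j → ¬? (A zero j ℤ.≟ 0ℤ))
... | yes (q , a≢0) = s≤s (independent⇒≤ _ (eliminate-independent A q a≢0 ind))
... | no ¬∃         = contradiction
        (λ j → decidable-stable (A zero j ℤ.≟ 0ℤ) λ a≢0 → ¬∃ (j , a≢0))
        (independent⇒nonzero-row A ind zero)

-- Two criteria for independence

-- Since F = CM, a relation cC = 0 gives cF = (cC)M = 0.
coefficients-independent : (F : Matrix r n) (M : Matrix m n) (C : Matrix r m) →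
                           (∀ i j → F i j ≡ ∑[ k < m ] (C i k * M k j)) →
                           LinearlyIndependent F → LinearlyIndependent C
coefficients-independent {r} {n} {m} F M C F≡CM ind =
  independent⁺ C λ c cC≡0 → independent⁻ F ind c λ j → begin
    ∑[ i < r ] (c i * F i j)
      ≡⟨ sum-cong-≋ (λ i → cong (c i *_) (F≡CM i j)) ⟩
    ∑[ i < r ] (c i * ∑[ k < m ] (C i k * M k j))
      ≡⟨ sum-cong-≋ (λ i → *-distribˡ-sum (c i) (λ k → C i k * M k j)) ⟩
    ∑[ i < r ] ∑[ k < m ] (c i * (C i k * M k j))
      ≡⟨ ∑-comm (λ i k → c i * (C i k * M k j)) ⟩
    ∑[ k < m ] ∑[ i < r ] (c i * (C i k * M k j))
      ≡⟨ sum-cong-≋ (λ k → sum-cong-≋ (λ i → ℤ.*-assoc (c i) (C i k) (M k j))) ⟨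
    ∑[ k < m ] ∑[ i < r ] (c i * C i k * M k j)
      ≡⟨ sum-cong-≋ (λ k → *-distribʳ-sum (M k j) (λ i → c i * C i k)) ⟨
    ∑[ k < m ] ((∑[ i < r ] (c i * C i k)) * M k j)
      ≡⟨ sum-zero _ (λ k → cong (_* M k j) (cC≡0 k)) ⟩
    0ℤ ∎
  where open ≡-Reasoning

-- In coordinate `p k` only the term of row `k` survives, which isolates `c k`.
diagonal-independent : (D : Matrix s n) (p : Fin s → Fin n) →
                       (∀ i → D i (p i) ≢ 0ℤ) →
                       (∀ i k → i ≢ k → D i (p k) ≡ 0ℤ) →
                       LinearlyIndependent D
diagonal-independent {s} D p diag off = independent⁺ D λ c cD≡0 k →
  *-cancelˡ-0 (diag k) (begin
    D k (p k) * c k                ≡⟨ ℤ.*-comm (D k (p k)) (c k) ⟩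
    c k * D k (p k)                ≡⟨ sum-single (λ i → c i * D i (p k)) k (λ i i≢k →
                                        trans (cong (c i *_) (off i k i≢k)) (ℤ.*-zeroʳ (c i))) ⟨
    ∑[ i < s ] (c i * D i (p k))   ≡⟨ cD≡0 (p k) ⟩
    0ℤ                             ∎)
  where open ≡-Reasoning

-- Enumerating the distinct elements of a finite family

module _ (S : Setoid 0ℓ 0ℓ) where
  open Setoid S using (_≈_) renaming (sym to ≈-sym)

  lookup-injective : ∀ {xs} → Unique S xs → Injective _≡_ _≈_ (lookup xs)
  lookup-injective {x ∷ xs} (x∉xs ∷ xs!) {zero}  {zero}  _   = refl
  lookup-injective {x ∷ xs} (x∉xs ∷ xs!) {zero}  {suc j} x≈y =
    contradiction x≈y (All.lookup x∉xs (∈-lookup j))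
  lookup-injective {x ∷ xs} (x∉xs ∷ xs!) {suc i} {zero}  y≈x =
    contradiction (≈-sym y≈x) (All.lookup x∉xs (∈-lookup i))
  lookup-injective {x ∷ xs} (x∉xs ∷ xs!) {suc i} {suc j} eq  =
    cong suc (lookup-injective xs! eq)

nonzeroColumns-enumeration : (M : Matrix m n) → ∃[ s ] HasSize (NonzeroColumn M) s
nonzeroColumns-enumeration {m} {n} M =
  length cols , lookup cols , lookup-injective S (deduplicate-! DS nonzeros) ,
  λ v → mk⇔ (to v) (from v)
  where
  DS = Pointwise.decSetoid ℤ.≡-decSetoid m
  open DecSetoid DS using (_≈_; _≟_) renaming (setoid to S; sym to ≈-sym; trans to ≈-trans)
  open Membership S using () renaming (_∈_ to _∈ₗ_)
  Nonzero? = λ v → ¬? (v ≟ λ _ → 0ℤ)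
  nonzeros cols : List (Vector ℤ m)
  nonzeros = filter Nonzero? (tabulate (column M))
  cols = deduplicate _≟_ nonzeros
  resp : ∀ {u v : Vector ℤ m} → u ≈ v → ¬ (u ≈ λ _ → 0ℤ) → ¬ (v ≈ λ _ → 0ℤ)
  resp u≈v u≉0 v≈0 = u≉0 (≈-trans u≈v v≈0)
  to : ∀ v → NonzeroColumn M v → ∃[ i ] v ≈ lookup cols i
  to v (v≉0 , j , v≈Mj) = Any.index v∈cols , Anyₚ.lookup-index v∈cols
    where
    v∈cols : v ∈ₗ cols
    v∈cols = Membershipₚ.∈-deduplicate⁺ S _≟_ (λ w≈v u≈v → ≈-trans u≈v (≈-sym w≈v))
      (Membershipₚ.∈-filter⁺ S Nonzero? resp (Anyₚ.tabulate⁺ j v≈Mj) v≉0)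
  from : ∀ v → ∃[ i ] v ≈ lookup cols i → NonzeroColumn M v
  from v (i , v≈) =
    let w∈tab , w≉0 = Membershipₚ.∈-filter⁻ S Nonzero? resp
          (Membershipₚ.∈-deduplicate⁻ S _≟_ nonzeros (Membershipₚ.∈-lookup S cols i))
        j , w≈Mj = Anyₚ.tabulate⁻ w∈tab
    in resp (≈-sym v≈) w≉0 , j , ≈-trans v≈ w≈Mj

-- Multiplicative sublattices

module _ (L : Sublattice n ℓ) (mult : Multiplicative L) where

  open Sublattice L using (+-closed; •-closed)

  -- As in Lagrange interpolation, `g` is multiplied by one factor u - u(q k) for each `k`. The
  -- factor vanishes at `q k` but not at `x`, and ℤ has no zero divisors.
  separate : (x : Fin n) (q : Fin t → Fin n) →
             (∃[ g ] g ∈ member L × g x ≢ 0ℤ) →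
             (∀ k → ∃[ u ] u ∈ member L × u x ≢ u (q k)) →
             ∃[ f ] f ∈ member L × f x ≢ 0ℤ × (∀ k → f (q k) ≡ 0ℤ)
  separate {t = zero}  x q (g , g∈L , gx≢0) sep = g , g∈L , gx≢0 , λ ()
  separate {t = suc t} x q nonzero          sep
    with f , f∈L , fx≢0 , f≡0 ← separate x (q ∘ suc) nonzero (sep ∘ suc)
       | u , u∈L , ux≢uq      ← sep zero
    = h , h∈L , hx≢0 , h≡0
    where
    -- h = f (u − u(q₀)), written without the constant vector, which need not lie in L.
    h : Vector ℤ n
    h j = f j * u j +ℤ (- u (q zero)) * f j
    h∈L : h ∈ member L
    h∈L = +-closed (mult f∈L u∈L) (•-closed (- u (q zero)) f∈L)
    h-factor : ∀ j → h j ≡ f j * (u j - u (q zero))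
    h-factor j = factor-difference (f j) (u j) (u (q zero))
    hx≢0 : h x ≢ 0ℤ
    hx≢0 hx≡0 = ux≢uq (ℤ.i-j≡0⇒i≡j (u x) (u (q zero))
      (*-cancelˡ-0 fx≢0 (trans (sym (h-factor x)) hx≡0)))
    h≡0 : ∀ k → h (q k) ≡ 0ℤ
    h≡0 zero    = trans (h-factor (q zero))
      (trans (cong (f (q zero) *_) (ℤ.i≡j⇒i-j≡0 {u (q zero)} refl)) (ℤ.*-zeroʳ (f (q zero))))
    h≡0 (suc k) = trans (h-factor (q (suc k))) (cong (_* (u (q (suc k)) - u (q zero))) (f≡0 k))

  separated⇒≤rank : HasRank L r → (p : Fin s → Fin n) →
                    (∀ i → ∃[ g ] g ∈ member L × g (p i) ≢ 0ℤ) →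
                    (∀ i k → i ≢ k → ∃[ u ] u ∈ member L × u (p i) ≢ u (p k)) →
                    s ≤ r
  separated⇒≤rank {s = zero}  rank p nonzero sep = z≤n
  -- With at least one point, `punchIn i` lists the indices other than `i`; separating `p i` from
  -- all of those points gives a diagonal family in `L`.
  separated⇒≤rank {s = suc s} rank p nonzero sep =
    HasRank.maximal rank (proj₁ ∘ vanishing) (proj₁ ∘ proj₂ ∘ vanishing)
      (diagonal-independent (proj₁ ∘ vanishing) p (proj₁ ∘ proj₂ ∘ proj₂ ∘ vanishing)
        λ i k i≢k → subst (λ k → proj₁ (vanishing i) (p k) ≡ 0ℤ)
          (punchIn-punchOut i≢k) (proj₂ (proj₂ (proj₂ (vanishing i))) (punchOut i≢k)))
    where
    vanishing : ∀ i → ∃[ f ] f ∈ member L × f (p i) ≢ 0ℤ ×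
                             (∀ k → f (p (punchIn i k)) ≡ 0ℤ)
    vanishing i = separate (p i) (p ∘ punchIn i) (nonzero i)
      λ k → sep i (punchIn i k) (punchInᵢ≢i i k ∘ sym)

  -- Choose one position `p i` for each distinct non-zero column. The rows of `M` themselves serve
  -- as the required vectors of `L`: some row is non-zero at `p i`, and some row differs at `p i`
  -- and `p k`, because the two columns differ.
  nonzeroColumns≤rank : HasRank L r → (M : Matrix m n) → (∀ i → M i ∈ member L) →
                        HasSize (NonzeroColumn M) s → s ≤ r
  nonzeroColumns≤rank {m = m} {s = s} rank M M∈L (e , e-injective , e-enumerates) =
    separated⇒≤rank rank p
      (λ i → let a , Ma≢0 = ¬∀⟶∃¬ m _ (λ a → M a (p i) ℤ.≟ 0ℤ)
                   (λ M≡0 → e≉0 i (λ a → trans (e≈M i a) (M≡0 a)))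
             in M a , M∈L a , Ma≢0)
      (λ i k i≢k → let a , Ma≢ = ¬∀⟶∃¬ m _ (λ a → M a (p i) ℤ.≟ M a (p k))
                         (λ M≡ → i≢k (e-injective λ a →
                           trans (e≈M i a) (trans (M≡ a) (sym (e≈M k a)))))
                   in M a , M∈L a , Ma≢)
    where
    e-nonzeroColumn : ∀ i → NonzeroColumn M (e i)
    e-nonzeroColumn i = Equivalence.from (e-enumerates (e i)) (i , λ _ → refl)
    p : Fin s → Fin n
    p i = proj₁ (proj₂ (e-nonzeroColumn i))
    e≈M : ∀ i a → e i a ≡ M a (p i)
    e≈M i a = proj₂ (proj₂ (e-nonzeroColumn i)) a
    e≉0 : ∀ i → ¬ (∀ a → e i a ≡ 0ℤ)
    e≉0 i e≡0 = proj₁ (e-nonzeroColumn i) λ a → e≡0 a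

-- Comparing rank, basis length and number of non-zero columns

-- Discarding zero and repeated columns discards no equation on the coefficients, so the transpose
-- of `e` still has `m` independent rows, now of length `s`.
rows≤nonzeroColumns : (M : Matrix m n) → LinearlyIndependent M →
                      HasSize (NonzeroColumn M) s → m ≤ s
rows≤nonzeroColumns {m} {n} M ind (e , _ , e-enumerates) =
  independent⇒≤ (λ a i → e i a) (independent⁺ _ λ c ce≡0 →
    independent⁻ M ind c (combination≡0 c ce≡0))
  where
  combination≡0 : ∀ c → (∀ i → ∑[ a < m ] (c a * e i a) ≡ 0ℤ) →
                  ∀ j → ∑[ a < m ] (c a * M a j) ≡ 0ℤ
  combination≡0 c ce≡0 j with all? (λ a → M a j ℤ.≟ 0ℤ)
  ... | yes Mj≡0 = sum-zero (λ a → c a * M a j) λ a →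
          trans (cong (c a *_) (Mj≡0 a)) (ℤ.*-zeroʳ (c a))
  ... | no Mj≢0 with i , Mj≈ei ← Equivalence.to (e-enumerates (column M j))
                       ((λ Mj≈0 → Mj≢0 λ a → Mj≈0 a) , j , λ _ → refl) =
          trans (sum-cong-≋ λ a → cong (c a *_) (Mj≈ei a)) (ce≡0 i)

rank≤basis : (L : Sublattice n ℓ) (M : Matrix m n) → HasRank L r → IsBasis L M → r ≤ m
rank≤basis L M rank basis =
  independent⇒≤ C (coefficients-independent family M C
    (λ i j → trans (proj₂ (spanning (members i)) j) (linearCombination-lookup (C i) M j))
    independent)
  where
  open HasRank rank
  open IsBasis basis using (spanning)
  C = λ i → proj₁ (spanning (members i))

theorem6 : (ℓ : Level) (n k : ℕ) → k ≤ n →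
    (L : Sublattice n ℓ) → Multiplicative L → HasCorank L k →
    (m : ℕ) (M : Matrix m n) → IsBasis L M →
    (m ≡ n ∸ k) × HasSize (NonzeroColumn M) (n ∸ k)
theorem6 ℓ n k _ L mult (r , rank , r+k≡n) m M basis =
  trans m≡r r≡n∸k , subst (HasSize (NonzeroColumn M)) (trans size≡r r≡n∸k) size
  where
  open IsBasis basis
  size = proj₂ (nonzeroColumns-enumeration M)
  r≡n∸k : r ≡ n ∸ k
  r≡n∸k = trans (sym (m+n∸n≡m r k)) (cong (_∸ k) r+k≡n)
  m≡r : m ≡ r
  m≡r = ≤-antisym (HasRank.maximal rank M members independent) (rank≤basis L M rank basis)
  -- With s the number of distinct non-zero columns, this closes the cycle s ≤ r ≤ m ≤ s.
  size≡r : proj₁ (nonzeroColumns-enumeration M) ≡ r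
  size≡r = ≤-antisym (nonzeroColumns≤rank L mult rank M members size)
    (≤-trans (rank≤basis L M rank basis) (rows≤nonzeroColumns M independent size))
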